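{- Let $p_i=p$ for all $i\in U$, where $|U|=n$ and $p=p(n)$ is a function of $n$ such that $\lim_{n\to\infty}p=1$ and $\lim_{n\to\infty}p^n=0$. Moreover, assume $p=1-\frac1{t_n}$, where $t_n$ is an increasing function of $n$ with $t_n=o(n)$. Then the greedy matching algorithm GM is a $\left(\frac{3(e-1)}{16e^2}-\Theta\left(\frac1{t_n}\right)\right)$-approximation for MaxOHP. That is, there is a function $\varepsilon(n)=\Theta(1/t_n)$, not depending on the instance, such that for all sufficiently large $n$, every $n$-element set $U$, every metric $d$ on $U$, and every ordering $O$ of $U$ output by GM, $$\mathcal{H}(O)\ \ge\ \Big(\tfrac{3(e-1)}{16e^2}-\varepsilon(n)\Big)\max_{O'}\mathcal{H}(O'),$$ the maximum being over all orderings $O'$ of $U$.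
   Context: For an ordering $O=(\pi(1),\dots,\pi(n))$ of $U$ with all continuation probabilities equal to $p$, the ordered Hamiltonian path objective is $\mathcal{H}(O)=\sum_{i=1}^{n-1}\big(\sum_{j=i+1}^np^j\big)d(\pi(i),\pi(i+1))$; MaxOHP asks to maximize $\mathcal{H}(O)$ over all orderings. Algorithm GM. Let $k=\lfloor n/2\rfloor$. Process all pairs $\{u,v\}$ of distinct items in non-increasing order of $d(u,v)$ (ties broken arbitrarily), adding a pair to $M$ whenever it is disjoint from all pairs already in $M$; this produces a matching $M=((u_1,v_1),(u_3,v_3),\dots,(u_{2k-1},v_{2k-1}))$ listed in the order of selection. The ordering $\pi$ is built from the end: if $n=2k+1$, let $\pi(2k+1)$ be the unique unmatched item. Then for $i=k,k-1,\dots,1$: if $i=k$ and $n=2k$, set $\pi(2k-1)=v_{2k-1}$ and $\pi(2k)=u_{2k-1}$; otherwise, if $d(v_{2i-1},\pi(2i+1))\ge d(u_{2i-1},\pi(2i+1))$ set $\pi(2i-1)=u_{2i-1}$, $\pi(2i)=v_{2i-1}$, else set $\pi(2i-1)=v_{2i-1}$, $\pi(2i)=u_{2i-1}$. Output $O=(\pi(1),\dots,\pi(n))$. -}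

module Defs where

open import Level using (Level; _⊔_) renaming (suc to lsuc)
open import Algebra.Bundles using (CommutativeRing)
open import Data.Bool.Base using (if_then_else_)
open import Data.Fin.Base using (Fin; zero; suc; toℕ; inject₁)
open import Data.List.Base using (List; []; _∷_; _∷ʳ_; foldr; tabulate)
open import Data.List.Membership.Propositional using (_∈_)
open import Data.List.Relation.Unary.All using (All)
open import Data.List.Relation.Unary.AllPairs using (AllPairs)
open import Data.Nat.Base as ℕ using (ℕ; zero; suc)
open import Data.Product.Base using (∃; _×_; _,_; uncurry)
open import Data.Sum.Base using (_⊎_)
open import Function.Bundles using (_↔_; Inverse)
open import Relation.Binary.Core using (Rel)
open import Relation.Binary.PropositionalEquality.Core using (_≡_; _≢_)
open import Relation.Binary.Structures using (IsDecTotalOrder)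
open import Relation.Nullary.Decidable.Core using (does)
open import Relation.Nullary.Negation.Core using (¬_)
import Algebra.Properties.CommutativeMonoid.Sum as MonoidSum
import Algebra.Properties.Semiring.Exp as SemiringExp
import Algebra.Properties.Semiring.Mult as SemiringMult
import Function.Metric.Structures as Metric

private
  variable
    u : Level

record OrderedField c ℓ₁ ℓ₂ : Set (lsuc (c ⊔ ℓ₁ ⊔ ℓ₂)) where
  infix  4 _≤_
  infix  8 _⁻¹
  field
    commutativeRing : CommutativeRing c ℓ₁

  open CommutativeRing commutativeRing public
    using (Carrier; _≈_; _+_; _*_; -_; _-_; 0#; 1#; semiring; +-commutativeMonoid)

  -- The inverse is total; nothing but congruence is known about 0# ⁻¹.
  field
    _≤_             : Rel Carrier ℓ₂
    isDecTotalOrder : IsDecTotalOrder _≈_ _≤_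
    +-monoˡ-≤       : ∀ {x y} z → x ≤ y → x + z ≤ y + z
    *-nonNeg        : ∀ {x y} → 0# ≤ x → 0# ≤ y → 0# ≤ x * y
    0#≉1#           : ¬ 0# ≈ 1#
    _⁻¹             : Carrier → Carrier
    ⁻¹-cong         : ∀ {x y} → x ≈ y → x ⁻¹ ≈ y ⁻¹
    *-inverseʳ      : ∀ {x} → ¬ x ≈ 0# → x * x ⁻¹ ≈ 1#

  open IsDecTotalOrder isDecTotalOrder public using (_≤?_)
  open SemiringExp semiring public using (_^_)
  open SemiringMult semiring using () renaming (_×_ to _·_)
  open MonoidSum +-commutativeMonoid public using (sum)

  infix  4 _<_
  infixl 7 _/_

  _<_ : Rel Carrier (ℓ₁ ⊔ ℓ₂)
  x < y = x ≤ y × ¬ x ≈ y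

  _/_ : Carrier → Carrier → Carrier
  x / y = x * y ⁻¹

  ∣_∣ : Carrier → Carrier
  ∣ x ∣ = if does (0# ≤? x) then x else - x

  fromℕ : ℕ → Carrier
  fromℕ n = n · 1#

module Asymptotics {c ℓ₁ ℓ₂} (F : OrderedField c ℓ₁ ℓ₂) where
  open OrderedField F

  Eventually : ∀ {ℓ} → (ℕ → Set ℓ) → Set ℓ
  Eventually P = ∃ λ N → ∀ n → N ℕ.≤ n → P n

  _⟶_ : (ℕ → Carrier) → Carrier → Set (c ⊔ ℓ₁ ⊔ ℓ₂)
  a ⟶ l = ∀ ε → 0# < ε → Eventually λ n → ∣ a n - l ∣ < ε

  Cauchy : (ℕ → Carrier) → Set (c ⊔ ℓ₁ ⊔ ℓ₂)
  Cauchy a = ∀ ε → 0# < ε →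
    ∃ λ N → ∀ m n → N ℕ.≤ m → N ℕ.≤ n → ∣ a m - a n ∣ < ε

  IsLittleO : (ℕ → Carrier) → (ℕ → Carrier) → Set (c ⊔ ℓ₁ ⊔ ℓ₂)
  IsLittleO f g = ∀ κ → 0# < κ → Eventually λ n → ∣ f n ∣ ≤ κ * ∣ g n ∣

  -- One-sided: f itself, not only ∣ f ∣, is bounded below by a positive
  -- multiple of ∣ g ∣.
  IsΘ : (ℕ → Carrier) → (ℕ → Carrier) → Set (c ⊔ ℓ₁ ⊔ ℓ₂)
  IsΘ f g = ∃ λ κ₁ → ∃ λ κ₂ → 0# < κ₁ × 0# < κ₂ ×
    Eventually λ n → κ₁ * ∣ g n ∣ ≤ f n × f n ≤ κ₂ * ∣ g n ∣

  -- e is the limit of (1 + 1/n)ⁿ, indexed from n = 1.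
  IsEuler : Carrier → Set (c ⊔ ℓ₁ ⊔ ℓ₂)
  IsEuler e = (λ n → (1# + 1# / fromℕ (suc n)) ^ suc n) ⟶ e

-- The classical real line, characterised up to isomorphism as the
-- Archimedean, Cauchy-complete ordered field.
record RealLine c ℓ₁ ℓ₂ : Set (lsuc (c ⊔ ℓ₁ ⊔ ℓ₂)) where
  field
    orderedField : OrderedField c ℓ₁ ℓ₂
  open OrderedField orderedField public
  open Asymptotics orderedField public
  field
    archimedean : ∀ x → ∃ λ n → x ≤ fromℕ n
    complete    : ∀ a → Cauchy a → ∃ λ l → a ⟶ l

Ordering : ℕ → Set u → Set u
Ordering n U = Fin n ↔ U

module _ {U : Set u} where

  SamePair : Rel (U × U) u
  SamePair (a , b) (x , y) = (a ≡ x × b ≡ y) ⊎ (a ≡ y × b ≡ x)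

  Avoids : U → U × U → Set u
  Avoids x (a , b) = x ≢ a × x ≢ b

  Disjoint : Rel (U × U) u
  Disjoint (a , b) e = Avoids a e × Avoids b e

  -- Greedy M L M′: processing the pairs of L in turn, starting from the
  -- matching M, ends with the matching M′ (both in order of selection).
  data Greedy (M : List (U × U)) : List (U × U) → List (U × U) → Set u where
    done : Greedy M [] M
    take : ∀ {e L M′} → All (Disjoint e) M →
           Greedy (M ∷ʳ e) L M′ → Greedy M (e ∷ L) M′
    skip : ∀ {e L M′} → ¬ All (Disjoint e) M →
           Greedy M L M′ → Greedy M (e ∷ L) M′

  data Leftover (n : ℕ) (M : List (U × U)) : List U → Set u where
    even : ∀ k → n ≡ 2 ℕ.* k → Leftover n M []
    odd  : ∀ k → n ≡ suc (2 ℕ.* k) → ∀ x → All (Avoids x) M →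
           Leftover n M (x ∷ [])

module OrderedHamiltonianPath {c ℓ₁ ℓ₂} (F : OrderedField c ℓ₁ ℓ₂) where
  open OrderedField F

  module _ {U : Set u} where

    IsMetric : (U → U → Carrier) → Set (c ⊔ ℓ₁ ⊔ ℓ₂ ⊔ u)
    IsMetric = Metric.IsGeneralMetric _≡_ _≈_ _≤_ 0# _+_

    -- weight p n i = ∑_{j=i+1}^{n} pʲ
    weight : Carrier → ℕ → ℕ → Carrier
    weight p n i = sum {n ℕ.∸ i} λ k → p ^ (suc i ℕ.+ toℕ k)

    -- Positions start at 0 in Fin n and at 1 in the weights.
    𝓗 : ∀ n → (U → U → Carrier) → Carrier → Ordering n U → Carrier
    𝓗 zero    d p O = 0#
    𝓗 (suc m) d p O = sum {m} λ r →
      weight p (suc m) (suc (toℕ r)) * d (π (inject₁ r)) (π (suc r))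
      where π = Inverse.to O

    IsMaximiser : ∀ n → (U → U → Carrier) → Carrier → Ordering n U →
                  Set (ℓ₂ ⊔ u)
    IsMaximiser n d p O = ∀ O′ → 𝓗 n d p O′ ≤ 𝓗 n d p O

    -- The order of the two components of each pair is arbitrary.
    record IsProcessingOrder (d : U → U → Carrier) (L : List (U × U))
                             : Set (ℓ₂ ⊔ u) where
      field
        distinct      : All (uncurry _≢_) L
        exhaustive    : ∀ a b → a ≢ b → (a , b) ∈ L ⊎ (b , a) ∈ L
        noRepetition  : AllPairs (λ e f → ¬ SamePair e f) L
        nonIncreasing : AllPairs (λ e f → uncurry d f ≤ uncurry d e) L

    -- Puts a matched pair in front of the part of the ordering already
    -- built; that part is empty exactly for the last pair when n is even.
    place : (U → U → Carrier) → U × U → List U → List U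
    place d (a , b) []       = b ∷ a ∷ []
    place d (a , b) (x ∷ xs) =
      if does (d a x ≤? d b x) then a ∷ b ∷ x ∷ xs else b ∷ a ∷ x ∷ xs

    record IsGMOutput (n : ℕ) (d : U → U → Carrier) (O : Ordering n U)
                      : Set (ℓ₂ ⊔ u) where
      field
        pairs           : List (U × U)
        processingOrder : IsProcessingOrder d pairs
        matching        : List (U × U)
        greedy          : Greedy [] pairs matching
        unmatched       : List U
        leftover        : Leftover n matching unmatched
        output          : tabulate (Inverse.to O) ≡ foldr (place d) unmatched matching

{-# OPTIONS --safe #-}

-- The output already attains a sixth of the optimum, for every n and every
-- decreasing sequence of weights w₀ ≥ w₁ ≥ … ≥ 0.  Let m₀ ≥ m₁ ≥ … be the
-- lengths of the greedy pairs; pair j occupies positions 2j and 2j+1, so that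
-- 𝓗(O) ≥ ∑ⱼ w₂ⱼ mⱼ.  Let eᵢ be the i-th edge of an arbitrary ordering, and
-- let c be the first greedy pair that meets eᵢ; then eᵢ is at most as long as
-- each of the pairs 0, …, c.  If 2c ≤ i, then wᵢ ∣eᵢ∣ ≤ w₂c m_c, otherwise
-- wᵢ ∣eᵢ∣ ≤ wᵢ m_⌊i/2⌋.  Each greedy pair meets at most four edges and each
-- value of ⌊i/2⌋ occurs twice, which gives 6 ∑ⱼ w₂ⱼ mⱼ in total.
--
-- On the other hand, 3(e - 1)/(16e²) ≤ 1/6 because e ≥ 1, so that
-- ε(n) = ∣1/tₙ∣ is a valid choice.
module Submission where

open import Defs
open import Data.Bool.Base using (true; false; if_then_else_)
open import Data.Fin.Base using (Fin; zero; suc; toℕ; inject₁)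
open import Data.Fin.Properties as Fin using (inject₁-injective; suc-injective)
open import Data.List.Base using (List; []; _∷_; _∷ʳ_; foldr; tabulate)
open import Data.List.Membership.Propositional using (_∈_)
open import Data.List.Relation.Unary.All as All using (All; []; _∷_)
open import Data.List.Relation.Unary.All.Properties using (∷ʳ⁺)
open import Data.List.Relation.Unary.AllPairs using (AllPairs; []; _∷_)
open import Data.List.Relation.Unary.Any using (here; there)
open import Data.Nat.Base as ℕ using (ℕ; zero; suc)
open import Data.Nat.Properties as ℕ using (pred[m∸n]≡m∸[1+n]; +-suc)
open import Data.Product.Base using (∃; _×_; _,_; proj₁; proj₂; uncurry)
open import Data.Sum.Base using (inj₁; inj₂; [_,_]′)
open import Function.Base using (_∘_; id)
open import Function.Bundles using (_↔_; Inverse; Injection)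
open import Function.Definitions using (Injective)
open import Function.Properties.Inverse using (↔⇒↣; ↔-sym)
open import Level using (_⊔_)
open import Relation.Binary.Bundles using (Poset)
open import Relation.Binary.Definitions using (Monotonic₁; DecidableEquality)
open import Relation.Binary.PropositionalEquality.Core as ≡ using (_≡_; _≢_)
open import Relation.Binary.Structures using (IsDecTotalOrder)
open import Relation.Nullary.Decidable
  using (Dec; yes; no; does; _×-dec_; ¬?; via-injection)
open import Relation.Nullary.Negation.Core using (¬_; contradiction)
open import Algebra.Bundles using (CommutativeRing)
import Algebra.Properties.Ring as RingProperties
import Algebra.Properties.Semiring.Sum as SemiringSum
import Algebra.Solver.Ring.NaturalCoefficients.Default as SemiringSolver
import Function.Metric.Structures as Metric
import Relation.Binary.Reasoning.PartialOrder as ≤-Reasoning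

-- Order arithmetic in ordered fields.

module OrderedFieldProperties {c ℓ₁ ℓ₂} (F : OrderedField c ℓ₁ ℓ₂) where

  open OrderedField F
  open CommutativeRing commutativeRing public
    using ( refl; sym; trans; reflexive; +-cong; +-congˡ; +-congʳ; +-comm; +-assoc
          ; +-identityˡ; +-identityʳ; -‿cong; *-cong; *-congˡ; *-congʳ; *-comm; *-assoc
          ; *-identityˡ; *-identityʳ; zeroʳ; distribˡ
          ; -‿inverseˡ; -‿inverseʳ; ring; commutativeSemiring)
  open IsDecTotalOrder isDecTotalOrder public using (total; antisym; isPartialOrder)
    renaming (reflexive to ≤-reflexive; trans to ≤-trans; refl to ≤-refl)
  open RingProperties ring public
    using (-‿distribʳ-*; -‿involutive; x[y-z]≈xy-xz)
  open SemiringSum semiring public using (∑-distrib-+; *-distribˡ-sum)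
  open SemiringSolver commutativeSemiring public using (Polynomial; solve; con; _:=_; _:+_; _:*_)

  poset : Poset c ℓ₁ ℓ₂
  poset = record { isPartialOrder = isPartialOrder }

  open ≤-Reasoning poset public

  +-monoʳ-≤ : ∀ {x y} z → x ≤ y → z + x ≤ z + y
  +-monoʳ-≤ {x} {y} z x≤y = begin
    z + x ≈⟨ +-comm z x ⟩
    x + z ≤⟨ +-monoˡ-≤ z x≤y ⟩
    y + z ≈⟨ +-comm y z ⟩
    z + y ∎

  +-mono-≤ : ∀ {x y u v} → x ≤ y → u ≤ v → x + u ≤ y + v
  +-mono-≤ x≤y u≤v = ≤-trans (+-monoˡ-≤ _ x≤y) (+-monoʳ-≤ _ u≤v)

  +-nonNeg : ∀ {x y} → 0# ≤ x → 0# ≤ y → 0# ≤ x + y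
  +-nonNeg 0≤x 0≤y = ≤-trans (≤-reflexive (sym (+-identityˡ 0#))) (+-mono-≤ 0≤x 0≤y)

  x≤x+y : ∀ {x y} → 0# ≤ y → x ≤ x + y
  x≤x+y {x} 0≤y = ≤-trans (≤-reflexive (sym (+-identityʳ x))) (+-monoʳ-≤ x 0≤y)

  x≤y+x : ∀ {x y} → 0# ≤ y → x ≤ y + x
  x≤y+x 0≤y = ≤-trans (x≤x+y 0≤y) (≤-reflexive (+-comm _ _))

  x-y+y≈x : ∀ x y → x - y + y ≈ x
  x-y+y≈x x y = trans (+-assoc x (- y) y) (trans (+-congˡ (-‿inverseˡ y)) (+-identityʳ x))

  x≤y⇒0≤y-x : ∀ {x y} → x ≤ y → 0# ≤ y - x
  x≤y⇒0≤y-x {x} x≤y = ≤-trans (≤-reflexive (sym (-‿inverseʳ x))) (+-monoˡ-≤ (- x) x≤y)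

  0≤y-x⇒x≤y : ∀ {x y} → 0# ≤ y - x → x ≤ y
  0≤y-x⇒x≤y {x} {y} 0≤y-x = begin
    x         ≤⟨ x≤y+x 0≤y-x ⟩
    y - x + x ≈⟨ x-y+y≈x y x ⟩
    y         ∎

  x-y≤x : ∀ {x y} → 0# ≤ y → x - y ≤ x
  x-y≤x {x} {y} 0≤y = ≤-trans (x≤x+y 0≤y) (≤-reflexive (x-y+y≈x x y))

  x≤0⇒0≤-x : ∀ {x} → x ≤ 0# → 0# ≤ - x
  x≤0⇒0≤-x x≤0 = ≤-trans (x≤y⇒0≤y-x x≤0) (≤-reflexive (+-identityˡ _))

  *-monoˡ-≤ : ∀ {x y z} → 0# ≤ z → x ≤ y → z * x ≤ z * y
  *-monoˡ-≤ {x} {y} {z} 0≤z x≤y =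
    0≤y-x⇒x≤y (≤-trans (*-nonNeg 0≤z (x≤y⇒0≤y-x x≤y)) (≤-reflexive (x[y-z]≈xy-xz z y x)))

  *-monoʳ-≤ : ∀ {x y z} → 0# ≤ z → x ≤ y → x * z ≤ y * z
  *-monoʳ-≤ 0≤z x≤y =
    ≤-trans (≤-reflexive (*-comm _ _)) (≤-trans (*-monoˡ-≤ 0≤z x≤y) (≤-reflexive (*-comm _ _)))

  *-mono-≤ : ∀ {x y u v} → 0# ≤ x → x ≤ y → 0# ≤ v → u ≤ v → x * u ≤ y * v
  *-mono-≤ 0≤x x≤y 0≤v u≤v = ≤-trans (*-monoˡ-≤ 0≤x u≤v) (*-monoʳ-≤ 0≤v x≤y)

  -- If `1# ≤ 0#`, then `- 1#` is nonnegative, and so is its square, which is `1#`.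
  0≤1 : 0# ≤ 1#
  0≤1 with total 0# 1#
  ... | inj₁ 0≤1 = 0≤1
  ... | inj₂ 1≤0 = begin
    0#              ≤⟨ *-nonNeg 0≤-1 0≤-1 ⟩
    (- 1#) * (- 1#) ≈⟨ -‿distribʳ-* (- 1#) 1# ⟨
    - ((- 1#) * 1#) ≈⟨ -‿cong (*-identityʳ (- 1#)) ⟩
    - (- 1#)        ≈⟨ -‿involutive 1# ⟩
    1#              ∎
    where
    0≤-1 : 0# ≤ - 1#
    0≤-1 = x≤0⇒0≤-x 1≤0

  1≰0 : ¬ 1# ≤ 0#
  1≰0 1≤0 = 0#≉1# (antisym 0≤1 1≤0)

  1≤x⇒0≤x : ∀ {x} → 1# ≤ x → 0# ≤ x
  1≤x⇒0≤x = ≤-trans 0≤1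

  1≤x⇒x≉0 : ∀ {x} → 1# ≤ x → ¬ x ≈ 0#
  1≤x⇒x≉0 1≤x x≈0 = 1≰0 (≤-trans 1≤x (≤-reflexive x≈0))

  1≤x⇒0≤x⁻¹ : ∀ {x} → 1# ≤ x → 0# ≤ x ⁻¹
  1≤x⇒0≤x⁻¹ {x} 1≤x with total 0# (x ⁻¹)
  ... | inj₁ 0≤x⁻¹ = 0≤x⁻¹
  ... | inj₂ x⁻¹≤0 = contradiction 1≤0 1≰0
    where
    1≤0 : 1# ≤ 0#
    1≤0 = begin
      1#       ≈⟨ *-inverseʳ (1≤x⇒x≉0 1≤x) ⟨
      x * x ⁻¹ ≤⟨ *-monoˡ-≤ (1≤x⇒0≤x 1≤x) x⁻¹≤0 ⟩
      x * 0#   ≈⟨ zeroʳ x ⟩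
      0#       ∎

  fromℕ-nonNeg : ∀ n → 0# ≤ fromℕ n
  fromℕ-nonNeg zero    = ≤-refl
  fromℕ-nonNeg (suc n) = +-nonNeg 0≤1 (fromℕ-nonNeg n)

  1≤fromℕ-suc : ∀ n → 1# ≤ fromℕ (suc n)
  1≤fromℕ-suc n = x≤x+y (fromℕ-nonNeg n)

  ^-nonNeg : ∀ {x} n → 0# ≤ x → 0# ≤ x ^ n
  ^-nonNeg zero    0≤x = 0≤1
  ^-nonNeg (suc n) 0≤x = *-nonNeg 0≤x (^-nonNeg n 0≤x)

  1≤*-mono : ∀ {x y} → 1# ≤ x → 1# ≤ y → 1# ≤ x * y
  1≤*-mono 1≤x 1≤y =
    ≤-trans (≤-reflexive (sym (*-identityʳ 1#))) (*-mono-≤ 0≤1 1≤x (1≤x⇒0≤x 1≤y) 1≤y)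

  1≤x^n : ∀ {x} n → 1# ≤ x → 1# ≤ x ^ n
  1≤x^n zero    1≤x = ≤-refl
  1≤x^n (suc n) 1≤x = 1≤*-mono 1≤x (1≤x^n n 1≤x)

  ∣x∣-nonNeg : ∀ x → 0# ≤ ∣ x ∣
  ∣x∣-nonNeg x with 0# ≤? x
  ... | yes 0≤x = 0≤x
  ... | no  0≰x = x≤0⇒0≤-x ([ (λ 0≤x → contradiction 0≤x 0≰x) , id ]′ (total 0# x))

  x≤∣x∣ : ∀ x → x ≤ ∣ x ∣
  x≤∣x∣ x with 0# ≤? x
  ... | yes _   = ≤-refl
  ... | no  0≰x = ≤-trans x≤0 (x≤0⇒0≤-x x≤0)
    where
    x≤0 : x ≤ 0#
    x≤0 = [ (λ 0≤x → contradiction 0≤x 0≰x) , id ]′ (total 0# x)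

  sum-nonNeg : ∀ {n} (f : Fin n → Carrier) → (∀ i → 0# ≤ f i) → 0# ≤ sum f
  sum-nonNeg {zero}  f 0≤f = ≤-refl
  sum-nonNeg {suc n} f 0≤f = +-nonNeg (0≤f zero) (sum-nonNeg (f ∘ suc) (0≤f ∘ suc))

  sum-mono-≤ : ∀ {n} (f g : Fin n → Carrier) → (∀ i → f i ≤ g i) → sum f ≤ sum g
  sum-mono-≤ {zero}  f g f≤g = ≤-refl
  sum-mono-≤ {suc n} f g f≤g =
    +-mono-≤ (f≤g zero) (sum-mono-≤ (f ∘ suc) (g ∘ suc) (f≤g ∘ suc))

  sum-zero : ∀ {n} (f : Fin n → Carrier) → (∀ i → f i ≈ 0#) → sum f ≈ 0#
  sum-zero {zero}  f f≈0 = refl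
  sum-zero {suc n} f f≈0 =
    trans (+-cong (f≈0 zero) (sum-zero (f ∘ suc) (f≈0 ∘ suc))) (+-identityʳ 0#)

  -- Limits, Euler's number and the approximation ratio.

  open Asymptotics F

  -- If `l` were below `b`, every term would stay at distance at least `b - l` from `l`; a single
  -- term beyond the threshold for `b - l` refutes this.
  limit-lowerBound : ∀ {a l b} → (∀ n → b ≤ a n) → a ⟶ l → b ≤ l
  limit-lowerBound {a} {l} {b} b≤a a⟶l with b ≤? l
  ... | yes b≤l = b≤l
  ... | no  b≰l = contradiction (antisym (proj₁ ∣aN-l∣<b-l) b-l≤∣aN-l∣) (proj₂ ∣aN-l∣<b-l)
    where
    l≤b : l ≤ b
    l≤b = [ (λ b≤l → contradiction b≤l b≰l) , id ]′ (total b l)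

    0<b-l : 0# < b - l
    0<b-l = x≤y⇒0≤y-x l≤b , λ 0≈b-l →
      b≰l (≤-reflexive (trans (sym (x-y+y≈x b l)) (trans (+-congʳ (sym 0≈b-l)) (+-identityˡ l))))

    N : ℕ
    N = proj₁ (a⟶l (b - l) 0<b-l)

    ∣aN-l∣<b-l : ∣ a N - l ∣ < b - l
    ∣aN-l∣<b-l = proj₂ (a⟶l (b - l) 0<b-l) N ℕ.≤-refl

    b-l≤∣aN-l∣ : b - l ≤ ∣ a N - l ∣
    b-l≤∣aN-l∣ = ≤-trans (+-monoˡ-≤ (- l) (b≤a N)) (x≤∣x∣ _)

  1≤euler : ∀ {e} → IsEuler e → 1# ≤ e
  1≤euler = limit-lowerBound λ n → 1≤x^n (suc n)
    (x≤x+y (*-nonNeg 0≤1 (1≤x⇒0≤x⁻¹ (1≤fromℕ-suc n))))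

  -- Unlike con n, its value is definitionally fromℕ n.
  numeral : ∀ {k} → ℕ → Polynomial k
  numeral zero    = con 0
  numeral (suc n) = con 1 :+ numeral n

  approximationRatio : Carrier → Carrier
  approximationRatio e = (fromℕ 3 * (e - 1#)) / (fromℕ 16 * e ^ 2)

  module _ {e} (1≤e : 1# ≤ e) where

    private
      1≤16e² : 1# ≤ fromℕ 16 * e ^ 2
      1≤16e² = 1≤*-mono (1≤fromℕ-suc 15) (1≤x^n 2 1≤e)

    approximationRatio-nonNeg : 0# ≤ approximationRatio e
    approximationRatio-nonNeg = *-nonNeg
      (*-nonNeg (fromℕ-nonNeg 3) (x≤y⇒0≤y-x 1≤e)) (1≤x⇒0≤x⁻¹ 1≤16e²)

    -- Clearing the denominator and putting `f = e - 1# ≥ 0` leaves 18f ≤ 16(f+1)².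
    6*approximationRatio≤1 : fromℕ 6 * approximationRatio e ≤ 1#
    6*approximationRatio≤1 = begin
      fromℕ 6 * (fromℕ 3 * f * y)   ≈⟨ *-assoc (fromℕ 6) (fromℕ 3 * f) y ⟨
      fromℕ 6 * (fromℕ 3 * f) * y   ≤⟨ *-monoʳ-≤ (1≤x⇒0≤x⁻¹ 1≤16e²) 18f≤16e² ⟩
      fromℕ 16 * e ^ 2 * y          ≈⟨ *-inverseʳ (1≤x⇒x≉0 1≤16e²) ⟩
      1#                            ∎
      where
      f y : Carrier
      f = e - 1#
      y = (fromℕ 16 * e ^ 2) ⁻¹

      0≤f : 0# ≤ f
      0≤f = x≤y⇒0≤y-x 1≤e

      18f≤16e² : fromℕ 6 * (fromℕ 3 * f) ≤ fromℕ 16 * e ^ 2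
      18f≤16e² = begin
        fromℕ 6 * (fromℕ 3 * f)
          -- The added term is the difference 16(f+1)² - 18f = 16f² + 14f + 16, whose coefficients
          -- are all nonnegative.
          ≤⟨ x≤x+y (+-nonNeg (+-nonNeg (*-nonNeg (fromℕ-nonNeg 16) (*-nonNeg 0≤f 0≤f))
                                      (*-nonNeg (fromℕ-nonNeg 14) 0≤f))
                             (fromℕ-nonNeg 16)) ⟩
        fromℕ 6 * (fromℕ 3 * f) + (fromℕ 16 * (f * f) + fromℕ 14 * f + fromℕ 16)
          -- The semiring solver knows no subtraction, so `e` enters as `f + fromℕ 1`; the nested
          -- product mirrors the unfolding of `e ^ 2`.
          ≈⟨ solve 1 (λ f → numeral 6 :* (numeral 3 :* f)
                              :+ (numeral 16 :* (f :* f) :+ numeral 14 :* f :+ numeral 16)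
                            := numeral 16 :* ((f :+ numeral 1) :* ((f :+ numeral 1) :* numeral 1))) refl f ⟩
        fromℕ 16 * ((f + fromℕ 1) * ((f + fromℕ 1) * fromℕ 1))
          ≈⟨ *-congˡ (*-cong f+1≈e (*-cong f+1≈e (+-identityʳ 1#))) ⟩
        fromℕ 16 * e ^ 2 ∎
        where
        f+1≈e : f + fromℕ 1 ≈ e
        f+1≈e = trans (+-congˡ (+-identityʳ 1#)) (x-y+y≈x e 1#)

-- Every pair is covered by the greedy matching.

module GreedyMatching {c ℓ₁ ℓ₂ u} (F : OrderedField c ℓ₁ ℓ₂)
  {U : Set u} (_≟_ : DecidableEquality U) (d : U → U → OrderedField.Carrier F)
  (d-nonNeg : ∀ x y → OrderedField._≤_ F (OrderedField.0# F) (d x y))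
  (d-sym : ∀ x y → OrderedField._≈_ F (d x y) (d y x)) where

  open OrderedField F
  open OrderedFieldProperties F
  open OrderedHamiltonianPath F

  len : U × U → Carrier
  len = uncurry d

  len-nonNeg : ∀ f → 0# ≤ len f
  len-nonNeg (a , b) = d-nonNeg a b

  avoids? : ∀ x (f : U × U) → Dec (Avoids x f)
  avoids? x (a , b) = ¬? (x ≟ a) ×-dec ¬? (x ≟ b)

  disjoint? : ∀ (e f : U × U) → Dec (Disjoint e f)
  disjoint? (a , b) f = avoids? a f ×-dec avoids? b f

  -- Up to and including the first pair of M that meets e, all pairs of M are
  -- at least as long as e.
  data Covered (e : U × U) : List (U × U) → Set (ℓ₂ ⊔ u) where
    here  : ∀ {f M} → len e ≤ len f → ¬ Disjoint e f → Covered e (f ∷ M)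
    there : ∀ {f M} → len e ≤ len f → Covered e M → Covered e (f ∷ M)

  AtMost : U × U → List (U × U) → Set (ℓ₂ ⊔ u)
  AtMost e = All (λ f → len e ≤ len f)

  covered-∷ʳ : ∀ {e f M} → Covered e M → Covered e (M ∷ʳ f)
  covered-∷ʳ (here e≤f meets)  = here e≤f meets
  covered-∷ʳ (there e≤f cover) = there e≤f (covered-∷ʳ cover)

  -- The case of a selected pair: it meets itself, and everything selected earlier is at least as
  -- long.
  covered-last : ∀ {e M} → AtMost e M → Covered e (M ∷ʳ e)
  covered-last []            = here ≤-refl λ disjoint → proj₁ (proj₁ disjoint) ≡.refl
  covered-last (e≤f ∷ e≤M) = there e≤f (covered-last e≤M)

  -- The case of a rejected pair: deciding disjointness from left to right finds the first selected
  -- pair that it meets.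
  covered-meets : ∀ {e M} → AtMost e M → ¬ All (Disjoint e) M → Covered e M
  covered-meets                 []          meets = contradiction [] meets
  covered-meets {e} {M = f ∷ _} (e≤f ∷ e≤M) meets with disjoint? e f
  ... | no  meets-f  = here e≤f meets-f
  ... | yes disjoint = there e≤f (covered-meets e≤M λ rest → meets (disjoint ∷ rest))

  covered-greedy : ∀ {e M L M′} → Covered e M → Greedy M L M′ → Covered e M′
  covered-greedy cover done              = cover
  covered-greedy cover (take _ greedy) = covered-greedy (covered-∷ʳ cover) greedy
  covered-greedy cover (skip _ greedy) = covered-greedy cover greedy

  -- The invariant is that every selected pair is at least as long as every pair still to be
  -- processed. Coverage obtained when a pair is processed persists, because later selections are
  -- appended at the end.
  greedy-covers : ∀ {M L M′} → AllPairs (λ e f → len f ≤ len e) L →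
                  All (λ e → AtMost e M) L → Greedy M L M′ →
                  ∀ {e} → e ∈ L → Covered e M′
  greedy-covers _ (e≤M ∷ _) (take _ greedy) (here ≡.refl) =
    covered-greedy (covered-last e≤M) greedy
  greedy-covers (L≤e ∷ sorted) (_ ∷ L≤M) (take _ greedy) (there e∈L) =
    -- Since the list is sorted, the newly selected pair is at least as long as all remaining ones,
    -- which restores the invariant.
    greedy-covers sorted (All.zipWith (λ (f≤M , f≤e) → ∷ʳ⁺ f≤M f≤e) (L≤M , L≤e)) greedy e∈L
  greedy-covers _ (e≤M ∷ _) (skip meets greedy) (here ≡.refl) =
    covered-greedy (covered-meets e≤M meets) greedy
  greedy-covers (_ ∷ sorted) (_ ∷ L≤M) (skip _ greedy) (there e∈L) =
    greedy-covers sorted L≤M greedy e∈L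

  -- Weighted paths and weighted matchings.

  -- Weights are kept abstract so that inductions can shift them: by one for an item dropped from a
  -- path, by two for a greedy pair.
  record IsWeighting (w : ℕ → Carrier) : Set ℓ₂ where
    field
      nonNeg     : ∀ i → 0# ≤ w i
      decreasing : ∀ i → w (suc i) ≤ w i

    w≤w₀ : ∀ i → w i ≤ w 0
    w≤w₀ zero    = ≤-refl
    w≤w₀ (suc i) = ≤-trans (decreasing i) (w≤w₀ i)

  open IsWeighting

  tail : ∀ {w} → IsWeighting w → IsWeighting (w ∘ suc)
  tail W = record { nonNeg = nonNeg W ∘ suc ; decreasing = decreasing W ∘ suc }

  value : (ℕ → Carrier) → List (U × U) → Carrier
  value w []      = 0#
  value w (f ∷ M) = w 0 * len f + value (w ∘ (2 ℕ.+_)) M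

  value-nonNeg : ∀ {w} → IsWeighting w → ∀ M → 0# ≤ value w M
  value-nonNeg W []      = ≤-refl
  value-nonNeg W (f ∷ M) =
    +-nonNeg (*-nonNeg (nonNeg W 0) (len-nonNeg f)) (value-nonNeg (tail (tail W)) M)

  pathLength : (ℕ → Carrier) → List U → Carrier
  pathLength w []           = 0#
  pathLength w (x ∷ [])     = 0#
  pathLength w (x ∷ y ∷ xs) = w 0 * d x y + pathLength (w ∘ suc) (y ∷ xs)

  pathLength-tabulate : ∀ {m} w (g : Fin (suc m) → U) →
    (sum {m} λ i → w (toℕ i) * d (g (inject₁ i)) (g (suc i))) ≈ pathLength w (tabulate g)
  pathLength-tabulate {zero}  w g = refl
  pathLength-tabulate {suc m} w g = +-congˡ (pathLength-tabulate (w ∘ suc) (g ∘ suc))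

  module _ {w} (W : IsWeighting w) where

    pathLength-∷ : ∀ x xs → pathLength (w ∘ suc) xs ≤ pathLength w (x ∷ xs)
    pathLength-∷ x []       = ≤-refl
    pathLength-∷ x (y ∷ xs) = x≤y+x (*-nonNeg (nonNeg W 0) (d-nonNeg x y))

    -- In either orientation the pair itself becomes the first edge, with weight `w 0`. The edge
    -- joining it to the later part, if there is one, only adds a nonnegative amount.
    value-place : ∀ f xs {v} → v ≤ pathLength (w ∘ (2 ℕ.+_)) xs →
                  w 0 * len f + v ≤ pathLength w (place d f xs)
    value-place (a , b) [] v≤ = +-mono-≤ (*-monoˡ-≤ (nonNeg W 0) (≤-reflexive (d-sym a b))) v≤
    value-place (a , b) (x ∷ xs) v≤ with does (d a x ≤? d b x)
    ... | true  = +-monoʳ-≤ _ (≤-trans v≤ (x≤y+x (*-nonNeg (nonNeg W 1) (d-nonNeg b x))))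
    ... | false = +-mono-≤ (*-monoˡ-≤ (nonNeg W 0) (≤-reflexive (d-sym a b)))
                           (≤-trans v≤ (x≤y+x (*-nonNeg (nonNeg W 1) (d-nonNeg a x))))

  pathLength-nonNeg : ∀ {w} → IsWeighting w → ∀ xs → 0# ≤ pathLength w xs
  pathLength-nonNeg W []       = ≤-refl
  pathLength-nonNeg W (x ∷ xs) = ≤-trans (pathLength-nonNeg (tail W) xs) (pathLength-∷ W x xs)

  value≤pathLength : ∀ {w} → IsWeighting w → ∀ M xs →
                     value w M ≤ pathLength w (foldr (place d) xs M)
  value≤pathLength W []      xs = pathLength-nonNeg W xs
  value≤pathLength W (f ∷ M) xs =
    value-place W f (foldr (place d) xs M) (value≤pathLength (tail (tail W)) M xs)

  -- The length m_⌊i/2⌋ of the greedy pair at half the index.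
  halfway : List (U × U) → ℕ → Carrier
  halfway []      i             = 0#
  halfway (f ∷ M) zero          = len f
  halfway (f ∷ M) (suc zero)    = len f
  halfway (f ∷ M) (suc (suc i)) = halfway M i

  halfway-nonNeg : ∀ M i → 0# ≤ halfway M i
  halfway-nonNeg []      i             = ≤-refl
  halfway-nonNeg (f ∷ M) zero          = len-nonNeg f
  halfway-nonNeg (f ∷ M) (suc zero)    = len-nonNeg f
  halfway-nonNeg (f ∷ M) (suc (suc i)) = halfway-nonNeg M i

  -- Indices 2j and 2j+1 both read the length of pair j, and the weight at 2j+1 is at most that at
  -- 2j. So each pair contributes at most twice its value.
  sum-halfway : ∀ {w} → IsWeighting w → ∀ M m →
    (sum {m} λ i → w (toℕ i) * halfway M (toℕ i)) ≤ value w M + value w M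
  sum-halfway W [] m =
    ≤-reflexive (trans (sum-zero {m} _ λ i → zeroʳ _) (sym (+-identityʳ 0#)))
  sum-halfway W M@(_ ∷ _) zero = +-nonNeg (value-nonNeg W M) (value-nonNeg W M)
  -- The sum may stop in the middle of a pair, which is then counted only once.
  sum-halfway W M@(f ∷ M′) (suc zero) =
    +-mono-≤ (x≤x+y (value-nonNeg (tail (tail W)) M′)) (value-nonNeg W M)
  sum-halfway {w} W (f ∷ M) (suc (suc m)) = begin
    a + (w 1 * len f + s)
      ≤⟨ +-monoʳ-≤ a (+-mono-≤ (*-monoʳ-≤ (len-nonNeg f) (decreasing W 0))
                               (sum-halfway (tail (tail W)) M m)) ⟩
    a + (a + (v + v))
      ≈⟨ solve 2 (λ a v → a :+ (a :+ (v :+ v)) := (a :+ v) :+ (a :+ v)) refl a v ⟩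
    (a + v) + (a + v) ∎
    where
    a v s : Carrier
    a = w 0 * len f
    v = value (w ∘ (2 ℕ.+_)) M
    s = sum {m} λ i → w (suc (suc (toℕ i))) * halfway M (toℕ i)

  -- Charging edges to the greedy pairs at their endpoints.

  δ : U → U → Carrier
  δ x y = if does (x ≟ y) then 1# else 0#

  δ-nonNeg : ∀ x y → 0# ≤ δ x y
  δ-nonNeg x y with does (x ≟ y)
  ... | true  = 0≤1
  ... | false = ≤-refl

  δ-≡ : ∀ {x y} → x ≡ y → δ x y ≈ 1#
  δ-≡ {x} {y} x≡y with x ≟ y
  ... | yes _   = refl
  ... | no  x≢y = contradiction x≡y x≢y

  δ-≢ : ∀ {x y} → x ≢ y → δ x y ≈ 0#
  δ-≢ {x} {y} x≢y with x ≟ y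
  ... | yes x≡y = contradiction x≡y x≢y
  ... | no  _   = refl

  -- By injectivity, once a term equals `1#` all later ones vanish.
  sum-δ≤1 : ∀ {m} x (g : Fin m → U) → Injective _≡_ _≡_ g → (sum λ i → δ x (g i)) ≤ 1#
  sum-δ≤1 {zero}  x g g-injective = 0≤1
  sum-δ≤1 {suc m} x g g-injective with x ≟ g zero
  ... | yes ≡.refl = ≤-reflexive (trans (+-congˡ (sum-zero _ λ i → δ-≢ (g₀≢ i))) (+-identityʳ 1#))
    where
    g₀≢ : ∀ i → g zero ≢ g (suc i)
    g₀≢ i g₀≡gᵢ with () ← g-injective g₀≡gᵢ
  ... | no _ = ≤-trans (≤-reflexive (+-identityˡ _))
                       (sum-δ≤1 x (g ∘ suc) (suc-injective ∘ g-injective))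

  incidence : U × U → U → Carrier
  incidence (a , b) x = δ a x + δ b x

  incidence-nonNeg : ∀ f x → 0# ≤ incidence f x
  incidence-nonNeg (a , b) x = +-nonNeg (δ-nonNeg a x) (δ-nonNeg b x)

  1≤incidence : ∀ f x → ¬ Avoids x f → 1# ≤ incidence f x
  1≤incidence (a , b) x ¬avoids with x ≟ a | x ≟ b
  ... | yes ≡.refl | _          = ≤-trans (≤-reflexive (sym (δ-≡ ≡.refl))) (x≤x+y (δ-nonNeg b x))
  ... | no _       | yes ≡.refl = ≤-trans (≤-reflexive (sym (δ-≡ ≡.refl))) (x≤y+x (δ-nonNeg a x))
  ... | no x≢a     | no x≢b     = contradiction (x≢a , x≢b) ¬avoids

  sum-incidence≤2 : ∀ {m} f (g : Fin m → U) → Injective _≡_ _≡_ g →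
                    (sum λ i → incidence f (g i)) ≤ 1# + 1#
  sum-incidence≤2 (a , b) g g-injective = ≤-trans
    (≤-reflexive (∑-distrib-+ (δ a ∘ g) (δ b ∘ g)))
    (+-mono-≤ (sum-δ≤1 a g g-injective) (sum-δ≤1 b g g-injective))

  1≤incidences : ∀ f x y → ¬ Disjoint (x , y) f → 1# ≤ incidence f x + incidence f y
  1≤incidences f x y meets with avoids? x f
  ... | no  ¬avoids = ≤-trans (1≤incidence f x ¬avoids) (x≤x+y (incidence-nonNeg f y))
  ... | yes avoids  = ≤-trans (1≤incidence f y λ avoids′ → meets (avoids , avoids′))
                              (x≤y+x (incidence-nonNeg f x))

  -- The value of the pair matched at x, and 0 if x is unmatched.
  charge : (ℕ → Carrier) → List (U × U) → U → Carrier
  charge w []      x = 0#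
  charge w (f ∷ M) x = w 0 * len f * incidence f x + charge (w ∘ (2 ℕ.+_)) M x

  charge-head-nonNeg : ∀ {w} → IsWeighting w → ∀ f x → 0# ≤ w 0 * len f * incidence f x
  charge-head-nonNeg W f x =
    *-nonNeg (*-nonNeg (nonNeg W 0) (len-nonNeg f)) (incidence-nonNeg f x)

  charge-nonNeg : ∀ {w} → IsWeighting w → ∀ M x → 0# ≤ charge w M x
  charge-nonNeg W []      x = ≤-refl
  charge-nonNeg W (f ∷ M) x =
    +-nonNeg (charge-head-nonNeg W f x) (charge-nonNeg (tail (tail W)) M x)

  -- A pair has two endpoints, and an injective `g` visits each at most once.
  sum-charge : ∀ {w} → IsWeighting w → ∀ M {m} (g : Fin m → U) → Injective _≡_ _≡_ g →
               (sum λ i → charge w M (g i)) ≤ value w M + value w M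
  sum-charge W [] {m} g _ = ≤-reflexive (trans (sum-zero {m} _ λ _ → refl) (sym (+-identityʳ 0#)))
  sum-charge {w} W (f ∷ M) g g-injective = begin
    (sum λ i → a * incidence f (g i) + charge (w ∘ (2 ℕ.+_)) M (g i))
      ≈⟨ ∑-distrib-+ (λ i → a * incidence f (g i)) (charge (w ∘ (2 ℕ.+_)) M ∘ g) ⟩
    (sum λ i → a * incidence f (g i)) + (sum λ i → charge (w ∘ (2 ℕ.+_)) M (g i))
      ≈⟨ +-congʳ (*-distribˡ-sum a (incidence f ∘ g)) ⟨
    a * (sum λ i → incidence f (g i)) + (sum λ i → charge (w ∘ (2 ℕ.+_)) M (g i))
      ≤⟨ +-mono-≤ (*-monoˡ-≤ (*-nonNeg (nonNeg W 0) (len-nonNeg f))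
                             (sum-incidence≤2 f g g-injective))
                  (sum-charge (tail (tail W)) M g g-injective) ⟩
    a * (1# + 1#) + (v + v)
      ≈⟨ solve 2 (λ a v → a :* (con 1 :+ con 1) :+ (v :+ v) := (a :+ v) :+ (a :+ v)) refl a v ⟩
    (a + v) + (a + v) ∎
    where
    a v : Carrier
    a = w 0 * len f
    v = value (w ∘ (2 ℕ.+_)) M

  -- The induction removes one greedy pair and two indices at a time. If the pair meeting the edge
  -- comes up first, one of the endpoints pays for the edge through `charge`. If the index drops to
  -- 0 or 1 first, the current pair is the one read by `halfway` and is at least as long as the
  -- edge.
  covered-edge : ∀ {w x y M} → IsWeighting w → Covered (x , y) M → ∀ i →
                 w i * d x y ≤ w i * halfway M i + (charge w M x + charge w M y)
  covered-edge {w} {x} {y} {f ∷ M} W (here e≤f meets) i = begin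
    w i * d x y
      -- The greedy pair has the smaller index, hence the larger weight.
      ≤⟨ *-mono-≤ (nonNeg W i) (w≤w₀ W i) (len-nonNeg f) e≤f ⟩
    a
      ≈⟨ *-identityʳ a ⟨
    a * 1#
      ≤⟨ *-monoˡ-≤ (*-nonNeg (nonNeg W 0) (len-nonNeg f)) (1≤incidences f x y meets) ⟩
    a * (incidence f x + incidence f y)
      ≈⟨ distribˡ a (incidence f x) (incidence f y) ⟩
    a * incidence f x + a * incidence f y
      ≤⟨ +-mono-≤ (x≤x+y (charge-nonNeg (tail (tail W)) M x))
                  (x≤x+y (charge-nonNeg (tail (tail W)) M y)) ⟩
    charge w (f ∷ M) x + charge w (f ∷ M) y
      ≤⟨ x≤y+x (*-nonNeg (nonNeg W i) (halfway-nonNeg (f ∷ M) i)) ⟩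
    w i * halfway (f ∷ M) i + (charge w (f ∷ M) x + charge w (f ∷ M) y) ∎
    where
    a : Carrier
    a = w 0 * len f
  covered-edge {x = x} {y} {f ∷ M} W (there e≤f _) zero =
    ≤-trans (*-monoˡ-≤ (nonNeg W 0) e≤f)
            (x≤x+y (+-nonNeg (charge-nonNeg W (f ∷ M) x) (charge-nonNeg W (f ∷ M) y)))
  covered-edge {x = x} {y} {f ∷ M} W (there e≤f _) (suc zero) =
    ≤-trans (*-monoˡ-≤ (nonNeg W 1) e≤f)
            (x≤x+y (+-nonNeg (charge-nonNeg W (f ∷ M) x) (charge-nonNeg W (f ∷ M) y)))
  covered-edge {x = x} {y} {f ∷ M} W (there _ cover) (suc (suc i)) =
    ≤-trans (covered-edge (tail (tail W)) cover i)
            (+-monoʳ-≤ _ (+-mono-≤ (x≤y+x (charge-head-nonNeg W f x))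
                                   (x≤y+x (charge-head-nonNeg W f y))))

  -- Comparing an arbitrary path with the greedy matching.

  module _ {L M} (order : IsProcessingOrder d L) (greedy : Greedy [] L M) where

    open IsProcessingOrder order

    distinct-covered : ∀ {e} → e ∈ L → Covered e M
    -- The invariant holds vacuously for the empty initial matching.
    distinct-covered = greedy-covers nonIncreasing (All.universal (λ _ → []) L) greedy

    greedy-edge : ∀ {w} → IsWeighting w → ∀ {x y} → x ≢ y → ∀ i →
                  w i * d x y ≤ w i * halfway M i + (charge w M x + charge w M y)
    -- The processing list may contain the pair in either orientation; symmetry of `d` settles the
    -- reversed one.
    greedy-edge {w} W {x} {y} x≢y i with exhaustive x y x≢y
    ... | inj₁ xy∈L = covered-edge W (distinct-covered xy∈L) i
    ... | inj₂ yx∈L = begin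
      w i * d x y ≈⟨ *-congˡ (d-sym x y) ⟩
      w i * d y x ≤⟨ covered-edge W (distinct-covered yx∈L) i ⟩
      w i * halfway M i + (charge w M y + charge w M x)
        ≈⟨ +-congˡ (+-comm (charge w M y) (charge w M x)) ⟩
      w i * halfway M i + (charge w M x + charge w M y) ∎

    -- The factor is 2 + 2 + 2: two from `halfway`, two from the charges at the starting points of
    -- the edges, two from those at their end points.
    pathLength≤6*value : ∀ {w} → IsWeighting w → ∀ {m} (g : Fin (suc m) → U) →
      Injective _≡_ _≡_ g → pathLength w (tabulate g) ≤ fromℕ 6 * value w M
    pathLength≤6*value {w} W {m} g g-injective = begin
      pathLength w (tabulate g)
        ≈⟨ pathLength-tabulate w g ⟨
      (sum {m} λ i → w (toℕ i) * d (g (inject₁ i)) (g (suc i)))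
        ≤⟨ sum-mono-≤ {m} _ _ (λ i → greedy-edge W (step-distinct i) (toℕ i)) ⟩
      (sum {m} λ i → half i + (from i + to i))
        ≈⟨ ∑-distrib-+ half (λ i → from i + to i) ⟩
      sum half + (sum {m} λ i → from i + to i)
        ≈⟨ +-congˡ (∑-distrib-+ from to) ⟩
      sum half + (sum from + sum to)
        ≤⟨ +-mono-≤ (sum-halfway W M m) (+-mono-≤
             (sum-charge W M (g ∘ inject₁) (inject₁-injective ∘ g-injective))
             (sum-charge W M (g ∘ suc) (suc-injective ∘ g-injective))) ⟩
      (v + v) + ((v + v) + (v + v))
        ≈⟨ solve 1 (λ v → (v :+ v) :+ ((v :+ v) :+ (v :+ v)) := numeral 6 :* v) refl v ⟩
      fromℕ 6 * v ∎
      where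
      v : Carrier
      v = value w M

      half from to : Fin m → Carrier
      half i = w (toℕ i) * halfway M (toℕ i)
      from i = charge w M (g (inject₁ i))
      to   i = charge w M (g (suc i))

      step-distinct : ∀ i → g (inject₁ i) ≢ g (suc i)
      step-distinct i = inject₁≢suc i ∘ g-injective
        where
        inject₁≢suc : ∀ {k} (i : Fin k) → inject₁ i ≢ suc i
        inject₁≢suc (suc i) = inject₁≢suc i ∘ suc-injective

-- The guarantee of GM for the path objective.

module GMApproximation {c ℓ₁ ℓ₂ u} (F : OrderedField c ℓ₁ ℓ₂) {U : Set u} where

  open OrderedField F
  open OrderedFieldProperties F
  open OrderedHamiltonianPath F

  weight-nonNeg : ∀ {p} → 0# ≤ p → ∀ n i → 0# ≤ weight {U = U} p n i
  weight-nonNeg {p} 0≤p n i = sum-nonNeg {n ℕ.∸ i} _ λ k → ^-nonNeg (suc i ℕ.+ toℕ k) 0≤p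

  -- Raising the index removes the first power of `p` from the sum. Writing the new number of terms
  -- as a predecessor also handles the case where both sums are empty.
  weight-decreasing : ∀ {p} → 0# ≤ p → ∀ n i → weight {U = U} p n (suc i) ≤ weight {U = U} p n i
  weight-decreasing {p} 0≤p n i =
    ≡.subst (λ l → (sum {l} λ k → p ^ (suc (suc i) ℕ.+ toℕ k)) ≤ weight {U = U} p n i)
            (pred[m∸n]≡m∸[1+n] n i) (drop-first (n ℕ.∸ i))
    where
    drop-first : ∀ l → (sum {ℕ.pred l} λ k → p ^ (suc (suc i) ℕ.+ toℕ k))
                       ≤ (sum {l} λ k → p ^ (suc i ℕ.+ toℕ k))
    drop-first zero    = ≤-refl
    drop-first (suc l) = ≤-trans
      (sum-mono-≤ {l} _ _ λ k →
        ≤-reflexive (reflexive (≡.cong (λ j → p ^ suc j) (≡.sym (+-suc i (toℕ k))))))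
      (x≤y+x (^-nonNeg (suc i ℕ.+ 0) 0≤p))

  𝓗-nonNeg : ∀ n {d p} → IsMetric d → 0# ≤ p → (O : Ordering n U) → 0# ≤ 𝓗 n d p O
  𝓗-nonNeg zero    _        _   _ = ≤-refl
  𝓗-nonNeg (suc m) d-metric 0≤p _ = sum-nonNeg {m} _ λ i →
    *-nonNeg (weight-nonNeg 0≤p (suc m) (suc (toℕ i))) (Metric.IsGeneralMetric.nonNegative d-metric)

  gm-approximation : ∀ n {d p} → IsMetric d → 0# ≤ p → (O : Ordering n U) → IsGMOutput n d O →
                     (O′ : Ordering n U) → 𝓗 n d p O′ ≤ fromℕ 6 * 𝓗 n d p O
  gm-approximation zero _ _ _ _ _ = ≤-reflexive (sym (zeroʳ (fromℕ 6)))
  gm-approximation (suc m) {d} {p} d-metric 0≤p O gm O′ = begin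
    𝓗 (suc m) d p O′
      ≈⟨ pathLength-tabulate w (Inverse.to O′) ⟩
    pathLength w (tabulate (Inverse.to O′))
      ≤⟨ pathLength≤6*value processingOrder greedy W (Inverse.to O′) (Injection.injective (↔⇒↣ O′)) ⟩
    fromℕ 6 * value w matching
      ≤⟨ *-monoˡ-≤ (fromℕ-nonNeg 6) (value≤pathLength W matching unmatched) ⟩
    fromℕ 6 * pathLength w (foldr (place d) unmatched matching)
      ≡⟨ ≡.cong (λ xs → fromℕ 6 * pathLength w xs) output ⟨
    fromℕ 6 * pathLength w (tabulate (Inverse.to O))
      ≈⟨ *-congˡ (pathLength-tabulate w (Inverse.to O)) ⟨
    fromℕ 6 * 𝓗 (suc m) d p O ∎
    where
    open IsGMOutput gm
    open Metric.IsGeneralMetric d-metric using (nonNegative) renaming (sym to d-sym)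
    -- Equality on `U` is decided by comparing positions in `O`.
    open GreedyMatching F (via-injection (↔⇒↣ (↔-sym O)) Fin._≟_) d (λ _ _ → nonNegative) d-sym

    w : ℕ → Carrier
    -- Edges are counted from 0 here and from 1 in `weight`.
    w i = weight {U = U} p (suc m) (suc i)

    W : IsWeighting w
    W = record
      { nonNeg     = λ i → weight-nonNeg 0≤p (suc m) (suc i)
      ; decreasing = λ i → weight-decreasing 0≤p (suc m) (suc i)
      }

theorem6p2 : ∀ {c ℓ₁ ℓ₂ u} (ℝ : RealLine c ℓ₁ ℓ₂) →
  let open RealLine ℝ
      open OrderedHamiltonianPath orderedField
  in
  (e : Carrier) → IsEuler e →
  (p t : ℕ → Carrier) →
  (∀ n → 0# ≤ p n × p n ≤ 1#) →
  p ⟶ 1# →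
  (λ n → p n ^ n) ⟶ 0# →
  (∀ n → ¬ t n ≈ 0#) →
  (∀ n → p n ≈ 1# - 1# / t n) →
  Monotonic₁ ℕ._≤_ _≤_ t →
  IsLittleO t fromℕ →
  ∃ λ (ε : ℕ → Carrier) → IsΘ ε (λ n → 1# / t n) ×
    Eventually λ n →
      (U : Set u) → Fin n ↔ U →
      (d : U → U → Carrier) → IsMetric d →
      (O : Ordering n U) → IsGMOutput n d O →
      (O* : Ordering n U) → IsMaximiser n d (p n) O* →
      ((fromℕ 3 * (e - 1#)) / (fromℕ 16 * e ^ 2) - ε n) * 𝓗 n d (p n) O*
        ≤ 𝓗 n d (p n) O
theorem6p2 ℝ e e-euler p t p∈[0,1] _ _ _ _ _ _ =
  (λ n → ∣ 1# / t n ∣) ,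
  -- Both Θ constants are 1, and the bounds hold from index 0 on.
  (1# , 1# , 0<1 , 0<1 , 0 , λ n _ →
    ≤-reflexive (*-identityˡ _) , ≤-reflexive (sym (*-identityˡ _))) ,
  0 , λ n _ U _ d d-metric O gm O* _ → let 0≤p = proj₁ (p∈[0,1] n) in begin
    (approximationRatio e - ∣ 1# / t n ∣) * 𝓗 n d (p n) O*
      -- The absolute value in `ε` makes the subtracted term nonnegative whatever the sign of `t n`.
      ≤⟨ *-monoʳ-≤ (𝓗-nonNeg n d-metric 0≤p O*) (x-y≤x (∣x∣-nonNeg (1# / t n))) ⟩
    approximationRatio e * 𝓗 n d (p n) O*
      ≤⟨ *-monoˡ-≤ (approximationRatio-nonNeg 1≤e) (gm-approximation n d-metric 0≤p O gm O*) ⟩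
    approximationRatio e * (fromℕ 6 * 𝓗 n d (p n) O)
      ≈⟨ *-assoc (approximationRatio e) (fromℕ 6) (𝓗 n d (p n) O) ⟨
    approximationRatio e * fromℕ 6 * 𝓗 n d (p n) O
      ≈⟨ *-congʳ (*-comm (approximationRatio e) (fromℕ 6)) ⟩
    fromℕ 6 * approximationRatio e * 𝓗 n d (p n) O
      ≤⟨ *-monoʳ-≤ (𝓗-nonNeg n d-metric 0≤p O) (6*approximationRatio≤1 1≤e) ⟩
    1# * 𝓗 n d (p n) O
      ≈⟨ *-identityˡ (𝓗 n d (p n) O) ⟩
    𝓗 n d (p n) O ∎
  where
  open RealLine ℝ
  open OrderedHamiltonianPath orderedField
  open OrderedFieldProperties orderedField
  open GMApproximation orderedField

  1≤e : 1# ≤ e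
  1≤e = 1≤euler e-euler

  0<1 : 0# < 1#
  0<1 = 0≤1 , 0#≉1#
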